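{- Let $\mathbb{K}$ be a class of frames definable in $\mathbf{K}$. Then $\mathbb{K}$ is definable in $\mathbf{K}\mathsf{biG}$ and $\mathbf{K}\mathsf{G}^2$.
   Context: A set of formulas $\Sigma$ defines a class of frames $\mathbb{K}$ in a logic $\mathbf{L}$ iff $\mathfrak{F}\in\mathbb{K}$ exactly when $\mathfrak{F}\models_\mathbf{L}\Sigma$. $\mathbf{K}$ is classical modal logic. $\mathbf{K}\mathsf{biG}$ is modal bi-Gödel logic on crisp frames: language over $\wedge,\vee,\rightarrow,\ominus$ (Gödel coimplication, $b\ominus_\mathsf{G}a=0$ if $b\le a$, else $b$), $\Box,\lozenge$, a single valuation into $[0,1]$ with Gödel operations ($\min$, $\max$, $a\rightarrow_\mathsf{G}b=1$ if $a\le b$ else $b$), $\Box$ as infimum and $\lozenge$ as supremum over $R$-successors, validity meaning value $1$ everywhere. $\mathbf{K}\mathsf{G}^2$ is its extension by a De Morgan negation $\neg$, interpreted on crisp frames with two valuations $v_1,v_2$ (support of truth/falsity) swapped by $\neg$, validity meaning $v_1=1$ and $v_2=0$ everywhere. $\mathbf{K}$ faithfully embeds into $\mathfrak{GK}^c$ (crisp modal Gödel logic) via $p\mapsto{\sim\sim}p$, where ${\sim}\phi:=\phi\rightarrow\mathbf{0}$; and $\mathbf{K}\mathsf{biG}$, $\mathbf{K}\mathsf{G}^2$ are conservative over $\mathfrak{GK}^c$ on crisp frames. -}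

module Defs where

open import Axiom.ExcludedMiddle using (ExcludedMiddle)
open import Data.Bool using (if_then_else_)
open import Data.Empty using (⊥)
open import Data.Nat using (ℕ)
open import Data.Product using (∃-syntax; _×_; _,_)
open import Data.Rational using (ℚ; 0ℚ; 1ℚ) renaming (_<_ to _<ℚ_)
open import Data.Rational.Properties using (<-dense; <-trans; <-cmp; positive⁻¹)
open import Data.Sum using (_⊎_; inj₁; inj₂)
open import Function using (_⇔_; id)
open import Level using (0ℓ; suc; _⊔_)
open import Relation.Binary.Definitions using (tri<; tri≈; tri>)
open import Relation.Binary.PropositionalEquality using (refl)
open import Relation.Nullary using (¬_; yes; no; contradiction)
open import Relation.Nullary.Decidable using (⌊_⌋)
open import Relation.Unary using (Pred; _∈_)

-- World is only required not to be empty: with a chosen element, a class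
-- of frames could depend on that choice.
record Frame : Set₁ where
  field
    World    : Set
    R        : World → World → Set
    nonempty : ¬ ¬ World

record Logic : Set₂ where
  field
    Formula : Set
    _⊨_     : Frame → Formula → Set₁

  _⊨ˢ_ : Frame → Pred Formula 0ℓ → Set₁
  F ⊨ˢ Γ = ∀ φ → φ ∈ Γ → F ⊨ φ

  Defines : ∀ {ℓ} → Pred Formula 0ℓ → Pred Frame ℓ → Set (suc 0ℓ ⊔ ℓ)
  Defines Γ 𝕂 = ∀ F → (F ∈ 𝕂) ⇔ (F ⊨ˢ Γ)

DefinableIn : ∀ {ℓ} → Logic → Pred Frame ℓ → Set (suc 0ℓ ⊔ ℓ)
DefinableIn L 𝕂 = ∃[ Γ ] Logic.Defines L Γ 𝕂

Var : Set
Var = ℕ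

infixr 7 _∧_
infixr 6 _∨_
infixr 5 _⇒_
infix  5 _⊖_

data FmK : Set where
  var         : Var → FmK
  𝟎           : FmK
  _∧_ _∨_ _⇒_ : FmK → FmK → FmK
  □ ◇         : FmK → FmK

data FmBiG : Set where
  var             : Var → FmBiG
  _∧_ _∨_ _⇒_ _⊖_ : FmBiG → FmBiG → FmBiG
  □ ◇             : FmBiG → FmBiG

data FmG² : Set where
  var             : Var → FmG²
  neg             : FmG² → FmG²
  _∧_ _∨_ _⇒_ _⊖_ : FmG² → FmG² → FmG²
  □ ◇             : FmG² → FmG²

module _ (F : Frame) (V : Var → Frame.World F → Set) where

  open Frame F

  -- This is the classical semantics once excluded middle is assumed.
  _⊩_ : World → FmK → Set
  w ⊩ var p   = V p w
  w ⊩ 𝟎       = ⊥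
  w ⊩ (φ ∧ ψ) = (w ⊩ φ) × (w ⊩ ψ)
  w ⊩ (φ ∨ ψ) = (w ⊩ φ) ⊎ (w ⊩ ψ)
  w ⊩ (φ ⇒ ψ) = w ⊩ φ → w ⊩ ψ
  w ⊩ □ φ     = ∀ u → R w u → u ⊩ φ
  w ⊩ ◇ φ     = ∃[ u ] R w u × (u ⊩ φ)

K : Logic
K = record
  { Formula = FmK
  ; _⊨_     = λ F φ → ∀ (V : Var → Frame.World F → Set) w → _⊩_ F V w φ
  }

-- The real interval [0,1]: x is represented by its Dedekind cut
-- { q ∈ ℚ ∣ q < x }. Under excluded middle a real number is the same thing
-- as its lower cut, so no upper cut is recorded.
record 𝕀 : Set₁ where
  field
    Below     : ℚ → Set
    ≥0        : ∀ {q} → q <ℚ 0ℚ → Below q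
    ≤1        : ∀ {q} → Below q → q <ℚ 1ℚ
    downwards : ∀ {q r} → q <ℚ r → Below r → Below q
    open-cut  : ∀ {q} → Below q → ∃[ r ] q <ℚ r × Below r

open 𝕀

infix 4 _≤_ _≈_

_≤_ : 𝕀 → 𝕀 → Set
x ≤ y = ∀ q → Below x q → Below y q

_≈_ : 𝕀 → 𝕀 → Set
x ≈ y = x ≤ y × y ≤ x

0<1 : 0ℚ <ℚ 1ℚ
0<1 = positive⁻¹ 1ℚ

0𝕀 : 𝕀
0𝕀 = record
  { Below     = _<ℚ 0ℚ
  ; ≥0        = id
  ; ≤1        = λ q<0 → <-trans q<0 0<1
  ; downwards = <-trans
  ; open-cut  = <-dense
  }

1𝕀 : 𝕀
1𝕀 = record
  { Below     = _<ℚ 1ℚ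
  ; ≥0        = λ q<0 → <-trans q<0 0<1
  ; ≤1        = id
  ; downwards = <-trans
  ; open-cut  = <-dense
  }

-- Supremum and infimum in [0,1] of { f i ∣ P i }; the empty family has
-- supremum 0 and infimum 1.
module _ {I : Set} (P : I → Set) (f : I → 𝕀) where

  ⋁ : 𝕀
  ⋁ = record
    { Below     = λ q → q <ℚ 0ℚ ⊎ (∃[ i ] P i × Below (f i) q)
    ; ≥0        = inj₁
    ; ≤1        = λ { (inj₁ q<0)          → <-trans q<0 0<1
                    ; (inj₂ (i , _ , q<)) → ≤1 (f i) q< }
    ; downwards = λ { q<r (inj₁ r<0)           → inj₁ (<-trans q<r r<0)
                    ; q<r (inj₂ (i , Pi , r<)) → inj₂ (i , Pi , downwards (f i) q<r r<) }
    ; open-cut  = λ { (inj₁ q<0) → let r , q<r , r<0 = <-dense q<0 in r , q<r , inj₁ r<0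
                    ; (inj₂ (i , Pi , q<)) → let r , q<r , r< = open-cut (f i) q< in
                        r , q<r , inj₂ (i , Pi , r<) }
    }

  -- The intersection of the cuts may have a greatest element, hence the r.
  ⋀ : 𝕀
  ⋀ = record
    { Below     = λ q → ∃[ r ] q <ℚ r × r <ℚ 1ℚ × (∀ i → P i → Below (f i) r)
    ; ≥0        = λ q<0 → let r , q<r , r<0 = <-dense q<0 in
                    r , q<r , <-trans r<0 0<1 , λ i _ → ≥0 (f i) r<0
    ; ≤1        = λ { (r , q<r , r<1 , _) → <-trans q<r r<1 }
    ; downwards = λ { p<q (r , q<r , rest) → r , <-trans p<q q<r , rest }
    ; open-cut  = λ { (r , q<r , rest) → let s , q<s , s<r = <-dense q<r in
                        s , q<s , r , s<r , rest }
    }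

  ⋁-upper : ∀ i → P i → f i ≤ ⋁
  ⋁-upper i Pi q q< = inj₂ (i , Pi , q<)

  ⋁-least : ∀ y → (∀ i → P i → f i ≤ y) → ⋁ ≤ y
  ⋁-least y ub q (inj₁ q<0)           = ≥0 y q<0
  ⋁-least y ub q (inj₂ (i , Pi , q<)) = ub i Pi q q<

  ⋀-lower : ∀ i → P i → ⋀ ≤ f i
  ⋀-lower i Pi q (r , q<r , _ , r<) = downwards (f i) q<r (r< i Pi)

  ⋀-greatest : ∀ y → (∀ i → P i → y ≤ f i) → y ≤ ⋀
  ⋀-greatest y lb q q< = let r , q<r , r< = open-cut y q< in
    r , q<r , ≤1 y r< , λ i Pi → lb i Pi r r<

-- The Gödel operations are defined by cases on the order of [0,1], which is
-- linear only classically; excluded middle is therefore a parameter.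
module Gödel (em : ExcludedMiddle 0ℓ) where

  ≤-total : ∀ x y → x ≤ y ⊎ y ≤ x
  ≤-total x y with em {∃[ q ] Below x q × ¬ Below y q}
  ... | no  none            = inj₁ λ q q<x → case q q<x
    where
    case : ∀ q → Below x q → Below y q
    case q q<x with em {Below y q}
    ... | yes q<y = q<y
    ... | no  q≮y = contradiction (q , q<x , q≮y) none
  ... | yes (q , q<x , q≮y) = inj₂ λ r r<y → case r r<y
    where
    case : ∀ r → Below y r → Below x r
    case r r<y with <-cmp r q
    ... | tri< r<q _ _    = downwards x r<q q<x
    ... | tri≈ _ refl _   = q<x
    ... | tri> _ _ q<r    = contradiction (downwards y q<r r<y) q≮y

  min max _→ᴳ_ _⊖ᴳ_ : 𝕀 → 𝕀 → 𝕀
  min a b = if ⌊ em {a ≤ b} ⌋ then a else b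
  max a b = if ⌊ em {a ≤ b} ⌋ then b else a
  a →ᴳ b  = if ⌊ em {a ≤ b} ⌋ then 1𝕀 else b
  b ⊖ᴳ a  = if ⌊ em {b ≤ a} ⌋ then 0𝕀 else b

  module _ (F : Frame) where

    open Frame F

    Valuation : Set₁
    Valuation = Var → World → 𝕀

    ⟦_⟧ : FmBiG → Valuation → World → 𝕀
    ⟦ var p ⟧ v w = v p w
    ⟦ φ ∧ ψ ⟧ v w = min (⟦ φ ⟧ v w) (⟦ ψ ⟧ v w)
    ⟦ φ ∨ ψ ⟧ v w = max (⟦ φ ⟧ v w) (⟦ ψ ⟧ v w)
    ⟦ φ ⇒ ψ ⟧ v w = ⟦ φ ⟧ v w →ᴳ ⟦ ψ ⟧ v w
    ⟦ φ ⊖ ψ ⟧ v w = ⟦ φ ⟧ v w ⊖ᴳ ⟦ ψ ⟧ v w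
    ⟦ □ φ ⟧   v w = ⋀ (R w) (⟦ φ ⟧ v)
    ⟦ ◇ φ ⟧   v w = ⋁ (R w) (⟦ φ ⟧ v)

    -- Support of truth and support of falsity. The second is computed with
    -- the order-dual operations.
    ⟦_⟧₁ ⟦_⟧₂ : FmG² → (v₁ v₂ : Valuation) → World → 𝕀
    ⟦ var p ⟧₁ v₁ v₂ w = v₁ p w
    ⟦ neg φ ⟧₁ v₁ v₂ w = ⟦ φ ⟧₂ v₁ v₂ w
    ⟦ φ ∧ ψ ⟧₁ v₁ v₂ w = min (⟦ φ ⟧₁ v₁ v₂ w) (⟦ ψ ⟧₁ v₁ v₂ w)
    ⟦ φ ∨ ψ ⟧₁ v₁ v₂ w = max (⟦ φ ⟧₁ v₁ v₂ w) (⟦ ψ ⟧₁ v₁ v₂ w)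
    ⟦ φ ⇒ ψ ⟧₁ v₁ v₂ w = ⟦ φ ⟧₁ v₁ v₂ w →ᴳ ⟦ ψ ⟧₁ v₁ v₂ w
    ⟦ φ ⊖ ψ ⟧₁ v₁ v₂ w = ⟦ φ ⟧₁ v₁ v₂ w ⊖ᴳ ⟦ ψ ⟧₁ v₁ v₂ w
    ⟦ □ φ ⟧₁   v₁ v₂ w = ⋀ (R w) (⟦ φ ⟧₁ v₁ v₂)
    ⟦ ◇ φ ⟧₁   v₁ v₂ w = ⋁ (R w) (⟦ φ ⟧₁ v₁ v₂)

    ⟦ var p ⟧₂ v₁ v₂ w = v₂ p w
    ⟦ neg φ ⟧₂ v₁ v₂ w = ⟦ φ ⟧₁ v₁ v₂ w
    ⟦ φ ∧ ψ ⟧₂ v₁ v₂ w = max (⟦ φ ⟧₂ v₁ v₂ w) (⟦ ψ ⟧₂ v₁ v₂ w)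
    ⟦ φ ∨ ψ ⟧₂ v₁ v₂ w = min (⟦ φ ⟧₂ v₁ v₂ w) (⟦ ψ ⟧₂ v₁ v₂ w)
    ⟦ φ ⇒ ψ ⟧₂ v₁ v₂ w = ⟦ ψ ⟧₂ v₁ v₂ w ⊖ᴳ ⟦ φ ⟧₂ v₁ v₂ w
    ⟦ φ ⊖ ψ ⟧₂ v₁ v₂ w = ⟦ ψ ⟧₂ v₁ v₂ w →ᴳ ⟦ φ ⟧₂ v₁ v₂ w
    ⟦ □ φ ⟧₂   v₁ v₂ w = ⋁ (R w) (⟦ φ ⟧₂ v₁ v₂)
    ⟦ ◇ φ ⟧₂   v₁ v₂ w = ⋀ (R w) (⟦ φ ⟧₂ v₁ v₂)

  KbiG : Logic
  KbiG = record
    { Formula = FmBiG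
    ; _⊨_     = λ F φ → ∀ (v : Valuation F) w → ⟦_⟧ F φ v w ≈ 1𝕀
    }

  KG² : Logic
  KG² = record
    { Formula = FmG²
    ; _⊨_     = λ F φ → ∀ (v₁ v₂ : Valuation F) w →
                  (⟦_⟧₁ F φ v₁ v₂ w ≈ 1𝕀) × (⟦_⟧₂ F φ v₁ v₂ w ≈ 0𝕀)
    }

{-# OPTIONS --safe #-}

-- Replacing every variable p by ∼∼p makes each subformula take only the
-- values 0 and 1, so that its value is the indicator of the classical truth
-- of the original formula, for the classical valuation "p has value > 0".
-- Every classical valuation arises in this way, from its own indicator, and
-- therefore validity on a frame is preserved and reflected. In KG² the
-- translation does not use the De Morgan negation, so v₁ and v₂ do not
-- interact: dually, the support of falsity is the indicator of the classical
-- falsity of the original formula for the valuation "p has v₂-value < 1".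
module Submission where

open import Defs
open import Axiom.ExcludedMiddle using (ExcludedMiddle)
open import Data.Empty using (⊥)
open import Data.Product using (_×_; _,_; proj₁; proj₂; ∃-syntax)
open import Data.Rational using (0ℚ)
open import Data.Rational.Properties using (<-irrefl)
open import Data.Sum using (_⊎_; inj₁; inj₂; [_,_])
open import Data.Bool using (if_then_else_)
open import Function using (_⇔_; mk⇔; Equivalence; id; _∘_)
open import Level using (0ℓ)
open import Relation.Binary.PropositionalEquality using (_≡_; refl)
open import Relation.Nullary using (¬_; yes; no; contradiction)
open import Relation.Nullary.Decidable using (⌊_⌋)
open import Relation.Unary using (Pred; _∈_)

≤-refl : ∀ {x} → x ≤ x
≤-refl q = id

≤-trans : ∀ {x y z} → x ≤ y → y ≤ z → x ≤ z
≤-trans x≤y y≤z q = y≤z q ∘ x≤y q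

x≤1𝕀 : ∀ x → x ≤ 1𝕀
x≤1𝕀 x q = 𝕀.≤1 x

0𝕀≤x : ∀ x → 0𝕀 ≤ x
0𝕀≤x x q = 𝕀.≥0 x

1𝕀≰0𝕀 : ¬ 1𝕀 ≤ 0𝕀
1𝕀≰0𝕀 1≤0 = <-irrefl refl (1≤0 0ℚ 0<1)

-- Each case stores only one inequality, since `x≤1𝕀` and `0𝕀≤x` supply the other. A proof also
-- decides `A`, so later case splits need no further appeal to excluded middle.
data Indicates (x : 𝕀) (A : Set) : Set where
  true  : A   → 1𝕀 ≤ x → Indicates x A
  false : ¬ A → x ≤ 0𝕀 → Indicates x A

private
  variable
    x y : 𝕀
    A B : Set

resp-⇔ : A ⇔ B → Indicates x A → Indicates x B
resp-⇔ A⇔B (true a 1≤x)   = true (Equivalence.to A⇔B a) 1≤x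
resp-⇔ A⇔B (false ¬a x≤0) = false (¬a ∘ Equivalence.from A⇔B) x≤0

indicates-≈1 : Indicates x A → A → x ≈ 1𝕀
indicates-≈1 {x} (true _ 1≤x) a = x≤1𝕀 x , 1≤x
indicates-≈1 (false ¬a _)     a = contradiction a ¬a

indicates-≈0 : Indicates x A → ¬ A → x ≈ 0𝕀
indicates-≈0 (true a _)        ¬a = contradiction a ¬a
indicates-≈0 {x} (false _ x≤0) ¬a = x≤0 , 0𝕀≤x x

≈1-indicates : Indicates x A → x ≈ 1𝕀 → A
≈1-indicates (true a _)        x≈1        = a
≈1-indicates {x} (false _ x≤0) (_ , 1≤x) = contradiction (≤-trans {1𝕀} {x} {0𝕀} 1≤x x≤0) 1𝕀≰0𝕀

-- This turns the order tests inside the Gödel operations into implications between propositions.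
≤⇔→ : Indicates x A → Indicates y B → (x ≤ y) ⇔ (A → B)
≤⇔→ {x} {A} {y} {B} ix iy = mk⇔ to (from ix)
  where
  to : x ≤ y → A → B
  to x≤y a = ≈1-indicates iy (x≤1𝕀 y , ≤-trans {1𝕀} {x} {y} (proj₂ (indicates-≈1 ix a)) x≤y)

  from : Indicates x A → (A → B) → x ≤ y
  from (true a _)    A→B = ≤-trans {x} {1𝕀} {y} (x≤1𝕀 x) (proj₂ (indicates-≈1 iy (A→B a)))
  from (false _ x≤0) A→B = ≤-trans {x} {0𝕀} {y} x≤0 (0𝕀≤x y)

-- The image of the defining set under `t` defines the same class.
DefinableIn-transfer :
  ∀ {L L′ : Logic} (t : Logic.Formula L → Logic.Formula L′) →
  (∀ F φ → Logic._⊨_ L F φ ⇔ Logic._⊨_ L′ F (t φ)) →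
  ∀ {ℓ} {𝕂 : Pred Frame ℓ} → DefinableIn L 𝕂 → DefinableIn L′ 𝕂
DefinableIn-transfer t ⊨⇔⊨ (Γ , def) =
    (λ ψ → ∃[ φ ] φ ∈ Γ × ψ ≡ t φ)
  , λ F → mk⇔
      (λ { F∈𝕂 _ (φ , φ∈Γ , refl) →
           Equivalence.to (⊨⇔⊨ F φ) (Equivalence.to (def F) F∈𝕂 φ φ∈Γ) })
      (λ F⊨ → Equivalence.from (def F) λ φ φ∈Γ →
           Equivalence.from (⊨⇔⊨ F φ) (F⊨ (t φ) (φ , φ∈Γ , refl)))

-- The target language has no constant for falsum; coimplication of any formula with itself always
-- has value 0.
𝟎ᴮ : FmBiG
𝟎ᴮ = var 0 ⊖ var 0

infixl 9 _ᴮ _²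

_ᴮ : FmK → FmBiG
var p ᴮ   = (var p ⇒ 𝟎ᴮ) ⇒ 𝟎ᴮ
𝟎 ᴮ       = 𝟎ᴮ
(φ ∧ ψ) ᴮ = φ ᴮ ∧ ψ ᴮ
(φ ∨ ψ) ᴮ = φ ᴮ ∨ ψ ᴮ
(φ ⇒ ψ) ᴮ = φ ᴮ ⇒ ψ ᴮ
□ φ ᴮ     = □ (φ ᴮ)
◇ φ ᴮ     = ◇ (φ ᴮ)

𝟎² : FmG²
𝟎² = var 0 ⊖ var 0

_² : FmK → FmG²
var p ²   = (var p ⇒ 𝟎²) ⇒ 𝟎²
𝟎 ²       = 𝟎²
(φ ∧ ψ) ² = φ ² ∧ ψ ²
(φ ∨ ψ) ² = φ ² ∨ ψ ²
(φ ⇒ ψ) ² = φ ² ⇒ ψ ²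
□ φ ²     = □ (φ ²)
◇ φ ²     = ◇ (φ ²)

module _ (em : ExcludedMiddle 0ℓ) where

  open Gödel em

  dne : ¬ ¬ A → A
  dne {A} ¬¬a with em {A}
  ... | yes a = a
  ... | no ¬a = contradiction ¬a ¬¬a

  indicator : Set → 𝕀
  indicator A = if ⌊ em {A} ⌋ then 1𝕀 else 0𝕀

  indicator-indicates : Indicates (indicator A) A
  indicator-indicates {A} with em {A}
  ... | yes a = true a (≤-refl {1𝕀})
  ... | no ¬a = false ¬a (≤-refl {0𝕀})

  ≰⇒≥ : ¬ x ≤ y → y ≤ x
  ≰⇒≥ {x} {y} x≰y = [ (λ x≤y → contradiction x≤y x≰y) , id ] (≤-total x y)

  min-indicates : Indicates x A → Indicates y B → Indicates (min x y) (A × B)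
  min-indicates {x} {y = y} ix iy with em {x ≤ y}
  ... | yes x≤y = resp-⇔ (mk⇔ (λ a → a , Equivalence.to (≤⇔→ ix iy) x≤y a) proj₁) ix
  ... | no  x≰y = resp-⇔ (mk⇔ (λ b → Equivalence.to (≤⇔→ iy ix) (≰⇒≥ {x} {y} x≰y) b , b) proj₂) iy

  max-indicates : Indicates x A → Indicates y B → Indicates (max x y) (A ⊎ B)
  max-indicates {x} {y = y} ix iy with em {x ≤ y}
  ... | yes x≤y = resp-⇔ (mk⇔ inj₂ [ Equivalence.to (≤⇔→ ix iy) x≤y , id ]) iy
  ... | no  x≰y = resp-⇔ (mk⇔ inj₁ [ id , Equivalence.to (≤⇔→ iy ix) (≰⇒≥ {x} {y} x≰y) ]) ix

  -- x →ᴳ y is two-valued as soon as y is, because x ≰ y excludes y = 1.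
  →ᴳ-indicates-≤ : ∀ x → Indicates y B → Indicates (x →ᴳ y) (x ≤ y)
  →ᴳ-indicates-≤ {y} x iy with em {x ≤ y} | iy
  ... | yes x≤y | _           = true x≤y (≤-refl {1𝕀})
  ... | no  x≰y | true _ 1≤y  = contradiction (≤-trans {x} {1𝕀} {y} (x≤1𝕀 x) 1≤y) x≰y
  ... | no  x≰y | false _ y≤0 = false x≰y y≤0

  -- Dual to the case of `→ᴳ`: only `y` has to be two-valued, because `y ≰ x` excludes `y` = 0.
  ⊖ᴳ-indicates-≰ : ∀ x → Indicates y B → Indicates (y ⊖ᴳ x) (¬ y ≤ x)
  ⊖ᴳ-indicates-≰ {y} x iy with em {y ≤ x} | iy
  ... | yes y≤x | _           = false (contradiction y≤x) (≤-refl {0𝕀})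
  ... | no  y≰x | true _ 1≤y  = true y≰x 1≤y
  ... | no  y≰x | false _ y≤0 = contradiction (≤-trans {y} {0𝕀} {x} y≤0 (0𝕀≤x x)) y≰x

  →ᴳ-indicates : Indicates x A → Indicates y B → Indicates (x →ᴳ y) (A → B)
  →ᴳ-indicates {x} ix iy = resp-⇔ (≤⇔→ ix iy) (→ᴳ-indicates-≤ x iy)

  ⊖ᴳ-indicates : Indicates x A → Indicates y B → Indicates (y ⊖ᴳ x) (¬ (B → A))
  ⊖ᴳ-indicates {x} ix iy =
    resp-⇔ (mk⇔ (_∘ Equivalence.from (≤⇔→ iy ix)) (_∘ Equivalence.to (≤⇔→ iy ix)))
           (⊖ᴳ-indicates-≰ x iy)

  ∼∼-indicates : Indicates x A → Indicates y ⊥ → Indicates ((x →ᴳ y) →ᴳ y) A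
  ∼∼-indicates ix iy =
    resp-⇔ (mk⇔ dne contradiction) (→ᴳ-indicates (→ᴳ-indicates ix iy) iy)

  x⊖ᴳx-indicates-⊥ : ∀ x → Indicates (x ⊖ᴳ x) ⊥
  x⊖ᴳx-indicates-⊥ x with em {x ≤ x}
  ... | yes _   = false id (≤-refl {0𝕀})
  ... | no  x≰x = contradiction (≤-refl {x}) x≰x

  x→ᴳx-indicates-¬⊥ : ∀ x → Indicates (x →ᴳ x) (¬ ⊥)
  x→ᴳx-indicates-¬⊥ x with em {x ≤ x}
  ... | yes _   = true id (≤-refl {1𝕀})
  ... | no  x≰x = contradiction (≤-refl {x}) x≰x

  module _ {I : Set} {P A : I → Set} {f : I → 𝕀}
           (if : ∀ i → Indicates (f i) (A i)) where

    -- Excluded middle either yields a counterexample, whose value 0 bounds the infimum, or shows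
    -- that every member of the family is 1.
    ⋀-indicates : Indicates (⋀ P f) (∀ i → P i → A i)
    ⋀-indicates with em {∃[ i ] P i × ¬ A i}
    ... | yes (i , Pi , ¬Ai) = false (λ all → ¬Ai (all i Pi))
      (≤-trans {⋀ P f} {f i} {0𝕀} (⋀-lower P f i Pi) (proj₁ (indicates-≈0 (if i) ¬Ai)))
    ... | no  none = true all
      (⋀-greatest P f 1𝕀 λ i Pi → proj₂ (indicates-≈1 (if i) (all i Pi)))
      where
      all : ∀ i → P i → A i
      all i Pi = dne λ ¬Ai → none (i , Pi , ¬Ai)

    ⋁-indicates : Indicates (⋁ P f) (∃[ i ] P i × A i)
    ⋁-indicates with em {∃[ i ] P i × A i}
    ... | yes (i , Pi , Ai) = true (i , Pi , Ai)
      (≤-trans {1𝕀} {f i} {⋁ P f} (proj₂ (indicates-≈1 (if i) Ai)) (⋁-upper P f i Pi))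
    ... | no  none = false none
      (⋁-least P f 0𝕀 λ i Pi → proj₁ (indicates-≈0 (if i) λ Ai → none (i , Pi , Ai)))

  module _ (F : Frame) where

    open Frame F

    module _ {v : Valuation F} {V : Var → World → Set}
             (atoms : ∀ p w → Indicates (⟦_⟧ F (var p ᴮ) v w) (V p w)) where

      -- The agreement on variables stays a hypothesis because one direction of `K⇔KbiG` builds `V`
      -- from `v` and the other builds `v` from `V`.
      ⟦ᴮ⟧-indicates : ∀ φ w → Indicates (⟦_⟧ F (φ ᴮ) v w) (_⊩_ F V w φ)
      ⟦ᴮ⟧-indicates (var p) w = atoms p w
      ⟦ᴮ⟧-indicates 𝟎       w = x⊖ᴳx-indicates-⊥ (v 0 w)
      ⟦ᴮ⟧-indicates (φ ∧ ψ) w = min-indicates (⟦ᴮ⟧-indicates φ w) (⟦ᴮ⟧-indicates ψ w)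
      ⟦ᴮ⟧-indicates (φ ∨ ψ) w = max-indicates (⟦ᴮ⟧-indicates φ w) (⟦ᴮ⟧-indicates ψ w)
      ⟦ᴮ⟧-indicates (φ ⇒ ψ) w = →ᴳ-indicates (⟦ᴮ⟧-indicates φ w) (⟦ᴮ⟧-indicates ψ w)
      ⟦ᴮ⟧-indicates (□ φ)   w = ⋀-indicates (⟦ᴮ⟧-indicates φ)
      ⟦ᴮ⟧-indicates (◇ φ)   w = ⋁-indicates (⟦ᴮ⟧-indicates φ)

    module _ {v₁ v₂ : Valuation F} {V : Var → World → Set} where

      ⟦²⟧₁-indicates :
        (∀ p w → Indicates (⟦_⟧₁ F (var p ²) v₁ v₂ w) (V p w)) →
        ∀ φ w → Indicates (⟦_⟧₁ F (φ ²) v₁ v₂ w) (_⊩_ F V w φ)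
      ⟦²⟧₁-indicates atoms = go
        where
        go : ∀ φ w → Indicates (⟦_⟧₁ F (φ ²) v₁ v₂ w) (_⊩_ F V w φ)
        go (var p) w = atoms p w
        go 𝟎       w = x⊖ᴳx-indicates-⊥ (v₁ 0 w)
        go (φ ∧ ψ) w = min-indicates (go φ w) (go ψ w)
        go (φ ∨ ψ) w = max-indicates (go φ w) (go ψ w)
        go (φ ⇒ ψ) w = →ᴳ-indicates (go φ w) (go ψ w)
        go (□ φ)   w = ⋀-indicates (go φ)
        go (◇ φ)   w = ⋁-indicates (go φ)

      -- The order-dual operations compute the negated formula by the De Morgan laws, classical ones
      -- for `∧`, `⇒` and `□`.
      ⟦²⟧₂-indicates :
        (∀ p w → Indicates (⟦_⟧₂ F (var p ²) v₁ v₂ w) (¬ V p w)) →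
        ∀ φ w → Indicates (⟦_⟧₂ F (φ ²) v₁ v₂ w) (¬ (_⊩_ F V w φ))
      ⟦²⟧₂-indicates atoms = go
        where
        go : ∀ φ w → Indicates (⟦_⟧₂ F (φ ²) v₁ v₂ w) (¬ (_⊩_ F V w φ))
        go (var p) w = atoms p w
        go 𝟎       w = x→ᴳx-indicates-¬⊥ (v₂ 0 w)
        go (φ ∧ ψ) w = resp-⇔
          (mk⇔ (λ { (inj₁ ¬φ) (a , _) → ¬φ a ; (inj₂ ¬ψ) (_ , b) → ¬ψ b })
               (λ ¬φψ → dne λ none → none (inj₁ λ a → none (inj₂ λ b → ¬φψ (a , b)))))
          (max-indicates (go φ w) (go ψ w))
        go (φ ∨ ψ) w = resp-⇔
          (mk⇔ (λ (¬φ , ¬ψ) → [ ¬φ , ¬ψ ]) (λ ¬φψ → ¬φψ ∘ inj₁ , ¬φψ ∘ inj₂))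
          (min-indicates (go φ w) (go ψ w))
        go (φ ⇒ ψ) w = resp-⇔
          -- The coimplication indicates the negation of "not ψ implies not φ"; contraposition
          -- inside it gives the negation of φ ⇒ ψ.
          (mk⇔ (λ h φ→ψ → h λ ¬ψ → ¬ψ ∘ φ→ψ)
               (λ h ¬ψ→¬φ → h λ a → dne λ ¬ψ → ¬ψ→¬φ ¬ψ a))
          (⊖ᴳ-indicates (go φ w) (go ψ w))
        go (□ φ)   w = resp-⇔
          (mk⇔ (λ (u , wRu , ¬φ) all → ¬φ (all u wRu))
               (λ ¬all → dne λ none → ¬all λ u wRu → dne λ ¬φ → none (u , wRu , ¬φ)))
          (⋁-indicates (go φ))
        go (◇ φ)   w = resp-⇔
          (mk⇔ (λ none (u , wRu , a) → none u wRu a)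
               (λ none u wRu a → none (u , wRu , a)))
          (⋀-indicates (go φ))

    K⇔KbiG : ∀ φ → Logic._⊨_ K F φ ⇔ Logic._⊨_ KbiG F (φ ᴮ)
    K⇔KbiG φ = mk⇔ to from
      where
      to : Logic._⊨_ K F φ → Logic._⊨_ KbiG F (φ ᴮ)
      to F⊨φ v w = indicates-≈1 (⟦ᴮ⟧-indicates atoms φ w) (F⊨φ _ w)
        where
        -- This type fixes the classical valuation left as `_` above: `p` holds where its value is
        -- positive.
        atoms : ∀ p u → Indicates (⟦_⟧ F (var p ᴮ) v u) (¬ v p u ≤ ⟦_⟧ F 𝟎ᴮ v u)
        atoms p u = →ᴳ-indicates (→ᴳ-indicates-≤ (v p u) z) z
          where z = x⊖ᴳx-indicates-⊥ (v 0 u)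

      from : Logic._⊨_ KbiG F (φ ᴮ) → Logic._⊨_ K F φ
      from F⊨φ V w = ≈1-indicates
        (⟦ᴮ⟧-indicates (λ p u → ∼∼-indicates indicator-indicates (x⊖ᴳx-indicates-⊥ _)) φ w)
        (F⊨φ (λ p u → indicator (V p u)) w)

    K⇔KG² : ∀ φ → Logic._⊨_ K F φ ⇔ Logic._⊨_ KG² F (φ ²)
    K⇔KG² φ = mk⇔ to from
      where
      to : Logic._⊨_ K F φ → Logic._⊨_ KG² F (φ ²)
      to F⊨φ v₁ v₂ w =
          -- Classical validity is used at two different valuations, one read off from `v₁` and one
          -- from `v₂`.
          indicates-≈1 (⟦²⟧₁-indicates atoms₁ φ w) (F⊨φ _ w)
        , indicates-≈0 (⟦²⟧₂-indicates atoms₂ φ w) (contradiction (F⊨φ _ w))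
        where
        atoms₁ : ∀ p u → Indicates (⟦_⟧₁ F (var p ²) v₁ v₂ u) (¬ v₁ p u ≤ ⟦_⟧₁ F 𝟎² v₁ v₂ u)
        atoms₁ p u = →ᴳ-indicates (→ᴳ-indicates-≤ (v₁ p u) z) z
          where z = x⊖ᴳx-indicates-⊥ (v₁ 0 u)

        -- The support of falsity of `𝟎²` is 1, so the inner negation says that the `v₂`-value of
        -- `p` is below 1; the outer one is the classical falsity of `p`.
        atoms₂ : ∀ p u → Indicates (⟦_⟧₂ F (var p ²) v₁ v₂ u) (¬ ¬ ⟦_⟧₂ F 𝟎² v₁ v₂ u ≤ v₂ p u)
        atoms₂ p u = resp-⇔
          (mk⇔ (λ h ≰ → h λ _ → ≰) (λ h g → h (g id)))
          (⊖ᴳ-indicates (⊖ᴳ-indicates-≰ (v₂ p u) o) o)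
          where o = x→ᴳx-indicates-¬⊥ (v₂ 0 u)

      from : Logic._⊨_ KG² F (φ ²) → Logic._⊨_ K F φ
      from F⊨φ V w = ≈1-indicates
        (⟦²⟧₁-indicates (λ p u → ∼∼-indicates indicator-indicates (x⊖ᴳx-indicates-⊥ _)) φ w)
        -- On translated formulas the support of truth depends on `v₁` alone, so a constant serves
        -- as `v₂`.
        (proj₁ (F⊨φ (λ p u → indicator (V p u)) (λ _ _ → 0𝕀) w))

theorem1 : (em : ExcludedMiddle 0ℓ) →
    ∀ {ℓ} (𝕂 : Pred Frame ℓ) →
    DefinableIn K 𝕂 →
    DefinableIn (Gödel.KbiG em) 𝕂 × DefinableIn (Gödel.KG² em) 𝕂
theorem1 em 𝕂 def = DefinableIn-transfer _ᴮ (K⇔KbiG em) def , DefinableIn-transfer _² (K⇔KG² em) def
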